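{- Let $n\ge 5$. Then the metric dimension of $L(n)$ is $n-2$.
   Context: For $n\ge 5$, $H(n)$ is the graph with vertex set $V_1\cup V_2$, where $V_1=\{v_1,\dots,v_n\}$ and $V_2=\{v_iv_j: 1\le i<j\le n\}$, and $v_r$ is adjacent to $v_iv_j$ iff $r\in\{i,j\}$ (no other edges). $L(n)$ is the line graph of $H(n)$: its vertices are the edges of $H(n)$, two being adjacent iff they share an endpoint. $d$ is the shortest-path distance; a set $Q$ of vertices is a resolving set of $G$ if any two distinct vertices $x,y$ satisfy $(d(x,q))_{q\in Q}\neq(d(y,q))_{q\in Q}$; the metric dimension is the minimum size of a resolving set. -}

module Defs where

open import Data.Empty using (⊥)
open import Data.Fin using (Fin; _<_)
open import Data.List using (List; length)
open import Data.List.Relation.Unary.All using (All)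
import Data.List.Relation.Unary.Unique.Setoid as UniqueSetoid
open import Data.Nat using (ℕ; zero; suc; _≤_)
open import Data.Product using (∃-syntax; _×_; _,_; proj₁)
open import Data.Sum using (_⊎_; inj₁; inj₂)
open import Function.Bundles using (_⇔_; module Equivalence)
open import Function.Properties.Equivalence using (⇔-isEquivalence)
open import Level using (0ℓ)
open import Relation.Binary.Bundles using (Setoid)
open import Relation.Binary.Core using (Rel)
open import Relation.Binary.Definitions using (Irreflexive; Symmetric; _Respects₂_)
open import Relation.Binary.PropositionalEquality using (_≡_; refl; setoid)
open import Relation.Binary.Structures using (IsEquivalence)
open import Relation.Nullary using (¬_)

-- Vertices form a setoid, because an edge (a vertex of the line graph) is
-- represented by an ordered pair of adjacent vertices, in either order.
record Graph : Set₁ where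
  infix 4 _~_
  field
    vertices : Setoid 0ℓ 0ℓ
  open Setoid vertices public using (_≈_) renaming (Carrier to Vertex)
  field
    _~_      : Rel Vertex 0ℓ
    ~-sym    : Symmetric _~_
    ~-irrefl : Irreflexive _≈_ _~_
    ~-resp-≈ : _~_ Respects₂ _≈_

module _ (G : Graph) where
  open Graph G

  data Walk : Vertex → Vertex → ℕ → Set where
    nil  : ∀ {x y} → x ≈ y → Walk x y zero
    cons : ∀ {x y z k} → x ~ y → Walk y z k → Walk x z (suc k)

  IsDistance : Vertex → Vertex → ℕ → Set
  IsDistance x y k = Walk x y k × (∀ m → Walk x y m → k ≤ m)

  -- d(x,q) = d(y,q); two vertices that both cannot reach q also have equal
  -- (infinite) distance to it.
  SameDistance : Vertex → Vertex → Vertex → Set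
  SameDistance x y q = ∀ k → IsDistance x q k ⇔ IsDistance y q k

  Resolving : List Vertex → Set
  Resolving Q = ∀ x y → ¬ (x ≈ y) → ¬ All (SameDistance x y) Q

  open UniqueSetoid vertices using (Unique)

  -- Finite sets of vertices are duplicate-free lists, so length is cardinality.
  MetricDimension : ℕ → Set
  MetricDimension k =
    (∃[ Q ] Unique Q × Resolving Q × length Q ≡ k) ×
    (∀ Q → Unique Q → Resolving Q → k ≤ length Q)

module _ (G : Graph) where
  open Graph G

  record Edge : Set where
    constructor edge
    field
      end₁ end₂ : Vertex
      adjacent  : end₁ ~ end₂

  infix 4 _∈ₑ_ _≈ₑ_

  _∈ₑ_ : Vertex → Edge → Set
  x ∈ₑ e = x ≈ Edge.end₁ e ⊎ x ≈ Edge.end₂ e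

  _≈ₑ_ : Rel Edge 0ℓ
  e ≈ₑ f = ∀ x → x ∈ₑ e ⇔ x ∈ₑ f

  edges : Setoid 0ℓ 0ℓ
  edges = record
    { Carrier       = Edge
    ; _≈_           = _≈ₑ_
    ; isEquivalence = record
      { refl  = λ x → ⇔.refl
      ; sym   = λ p x → ⇔.sym (p x)
      ; trans = λ p q x → ⇔.trans (p x) (q x)
      }
    }
    where module ⇔ = IsEquivalence (⇔-isEquivalence {0ℓ})

  lineGraph : Graph
  lineGraph = record
    { vertices = edges
    ; _~_      = λ e f → ¬ (e ≈ₑ f) × (∃[ x ] x ∈ₑ e × x ∈ₑ f)
    ; ~-sym    = λ { {e} {f} (e≉f , x , x∈e , x∈f) →
                   (λ f≈e → e≉f (≈.sym {f} {e} f≈e)) , x , x∈f , x∈e }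
    ; ~-irrefl = λ e≈f e~f → proj₁ e~f e≈f
    ; ~-resp-≈ =
        (λ { {e} {f} {g} f≈g (e≉f , x , x∈e , x∈f) →
               (λ e≈g → e≉f (≈.trans {e} {g} {f} e≈g (≈.sym {f} {g} f≈g))) ,
               x , x∈e , Equivalence.to (f≈g x) x∈f }) ,
        (λ { {f} {e} {g} e≈g (e≉f , x , x∈e , x∈f) →
               (λ g≈f → e≉f (≈.trans {e} {g} {f} e≈g g≈f)) ,
               x , Equivalence.to (e≈g x) x∈e , x∈f })
    }
    where module ≈ = Setoid edges

-- point r is v_r and pair i j is v_iv_j; the proof of i < j is irrelevant, so
-- propositional equality of vertices is equality of indices.
data HVertex (n : ℕ) : Set where
  point : Fin n → HVertex n
  pair  : (i j : Fin n) → .(i < j) → HVertex n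

HAdjacent : ∀ {n} → Rel (HVertex n) 0ℓ
HAdjacent (point r)    (pair i j _) = r ≡ i ⊎ r ≡ j
HAdjacent (pair i j _) (point r)    = r ≡ i ⊎ r ≡ j
HAdjacent (point _)    (point _)    = ⊥
HAdjacent (pair _ _ _) (pair _ _ _) = ⊥

H : ℕ → Graph
H n = record
  { vertices = setoid (HVertex n)
  ; _~_      = HAdjacent
  ; ~-sym    = λ {x} {y} → symmetric x y
  ; ~-irrefl = λ { {x} refl → irreflexive x }
  ; ~-resp-≈ = (λ { refl p → p }) , (λ { refl p → p })
  }
  where
  symmetric : ∀ (x y : HVertex n) → HAdjacent x y → HAdjacent y x
  symmetric (point _)    (pair _ _ _) p = p
  symmetric (pair _ _ _) (point _)    p = p

  irreflexive : ∀ (x : HVertex n) → ¬ HAdjacent x x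
  irreflexive (point _)    ()
  irreflexive (pair _ _ _) ()

L : ℕ → Graph
L n = lineGraph (H n)

{-# OPTIONS --safe #-}

-- A vertex of L(n) is determined by its tail r and its head s, where it is the
-- edge of H(n) joining v_r to v_r v_s.  Then (r , s) and (p , q) are adjacent
-- iff they have the same tail or are reverse to each other, so that their
-- distance is [s ≠ q] if r = p and [s ≠ p] + 1 + [r ≠ q] otherwise.
--
-- For fixed points a and b, the n - 2 vertices (i , a) with i ∉ {a , b} are
-- resolving.  The distance from (r , s) to (i , a) is at most 1 if r = i, at
-- most 2 if r = a, and at least 2 if r ∉ {a , i}, with equality only for s = i;
-- so the distances determine r, and then s.
--
-- Conversely, fewer than n - 2 vertices leave three points a, b, c that are not
-- tails of any of them, and then they do not separate (a , b) from (a , c).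
module Submission where

open import Defs
open import Data.Empty using (⊥-elim-irr)
open import Data.Fin using (Fin; zero; suc; _<_; _<?_; _≟_)
open import Data.Fin.Properties
  using (<-cmp; <-asym; <⇒≢; injective⇒≤; ¬∀⟶∃¬; suc-injective)
open import Data.List using (List; []; _∷_; length; map; tabulate)
open import Data.List.Membership.Propositional using (_∈_; _∉_)
open import Data.List.Membership.Propositional.Properties using (∈-map⁺)
open import Data.List.Properties using (length-map; length-tabulate)
import Data.List.Membership.DecPropositional as DecMembership
import Data.List.Membership.Setoid.Properties as Membershipₛ
open import Data.List.Relation.Unary.All as All using (All)
open import Data.List.Relation.Unary.All.Properties using (tabulate⁻)
open import Data.List.Relation.Unary.Any using (here; there; index)
import Data.List.Relation.Unary.Unique.Setoid.Properties as Uniqueₛ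
open import Data.Nat using (ℕ; suc; _+_; _≤_; _∸_; z≤n; s≤s)
import Data.Nat as ℕ
import Data.Nat.Properties as ℕ
open import Data.Product using (∃-syntax; _×_; _,_; proj₁; proj₂)
open import Data.Sum as Sum using (_⊎_; inj₁; inj₂)
open import Function using (_∘_; id)
open import Function.Bundles using (_⇔_; mk⇔; module Equivalence)
open import Relation.Binary.Bundles using (Setoid)
open import Relation.Binary.Definitions using (tri<; tri≈; tri>)
open import Relation.Binary.PropositionalEquality
  using (_≡_; _≢_; refl; sym; trans; cong; cong₂; subst; subst₂; ≢-sym; setoid)
open import Relation.Nullary using (¬_; yes; no; contradiction)
open import Relation.Nullary.Decidable using (recompute)

open Equivalence using (to; from)

-- Walks and distances in an arbitrary graph.

module _ (G : Graph) where
  open Graph G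
  private module ≈ = Setoid vertices

  walk-++ : ∀ {x y z k l} → Walk G x y k → Walk G y z l → Walk G x z (k + l)
  walk-++ (nil x≈y)    (nil y≈z)    = nil (≈.trans x≈y y≈z)
  walk-++ (nil x≈y)    (cons y~w v) = cons (proj₂ ~-resp-≈ (≈.sym x≈y) y~w) v
  walk-++ (cons x~w u) v            = cons x~w (walk-++ u v)

  -- Each step lowers `f` by at most one. With a candidate distance to a fixed vertex as `f`, this
  -- bounds the length of every walk from below.
  walk-lipschitz : (f : Vertex → ℕ) →
    (∀ {x y} → x ≈ y → f x ≤ f y) →
    (∀ {x y} → x ~ y → f x ≤ suc (f y)) →
    ∀ {x y k} → Walk G x y k → f x ≤ k + f y
  walk-lipschitz f ≈-mono ~-step (nil x≈y)    = ≈-mono x≈y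
  walk-lipschitz f ≈-mono ~-step (cons x~w u) =
    ℕ.≤-trans (~-step x~w) (s≤s (walk-lipschitz f ≈-mono ~-step u))

  IsDistance-unique : ∀ {x y k l} → IsDistance G x y k → IsDistance G x y l → k ≡ l
  IsDistance-unique (u , k-min) (v , l-min) = ℕ.≤-antisym (k-min _ v) (l-min _ u)

  module _ {d : Vertex → Vertex → ℕ} (isDistance : ∀ x y → IsDistance G x y (d x y)) where

    SameDistance⇒≡ : ∀ {x y q} → SameDistance G x y q → d x q ≡ d y q
    SameDistance⇒≡ {x} {y} {q} same =
      IsDistance-unique (to (same (d x q)) (isDistance x q)) (isDistance y q)

    ≡⇒SameDistance : ∀ {x y q} → d x q ≡ d y q → SameDistance G x y q
    ≡⇒SameDistance {x} {y} {q} eq k = mk⇔ (transfer eq) (transfer (sym eq))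
      where
      transfer : ∀ {x y} → d x q ≡ d y q → IsDistance G x q k → IsDistance G y q k
      transfer {x} {y} eq xq = subst (IsDistance G y q)
        (trans (sym eq) (IsDistance-unique (isDistance x q) xq)) (isDistance y q)

-- Pigeonhole: if every point occurred in `xs`, its position would give an injection of `Fin n` into
-- the positions of `xs`.
∃-∉ : ∀ {n} (xs : List (Fin n)) → length xs ℕ.< n → ∃[ x ] x ∉ xs
∃-∉ {n} xs short = ¬∀⟶∃¬ n (_∈ xs) (_∈? xs) λ all∈ →
  ℕ.<⇒≱ short (injective⇒≤ {f = index ∘ all∈}
    (Membershipₛ.index-injective (setoid (Fin n)) (all∈ _) (all∈ _)))
  where open DecMembership (_≟_ {n}) using (_∈?_)

-- The distance formula on codes (tail , head).

module _ {n : ℕ} where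

  diff : Fin n → Fin n → ℕ
  diff i j with i ≟ j
  ... | yes _ = 0
  ... | no  _ = 1

  diff-≡ : ∀ {i j} → i ≡ j → diff i j ≡ 0
  diff-≡ {i} {j} i≡j with i ≟ j
  ... | yes _   = refl
  ... | no  i≢j = contradiction i≡j i≢j

  diff-≢ : ∀ {i j} → i ≢ j → diff i j ≡ 1
  diff-≢ {i} {j} i≢j with i ≟ j
  ... | yes i≡j = contradiction i≡j i≢j
  ... | no  _   = refl

  diff-≤1 : ∀ i j → diff i j ≤ 1
  diff-≤1 i j with i ≟ j
  ... | yes _ = z≤n
  ... | no  _ = ℕ.≤-refl

  diff≡0⇒≡ : ∀ {i j} → diff i j ≡ 0 → i ≡ j
  diff≡0⇒≡ {i} {j} eq with i ≟ j
  ... | yes i≡j = i≡j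

  dist : (r s p q : Fin n) → ℕ
  dist r s p q with r ≟ p
  ... | yes _ = diff s q
  ... | no  _ = diff s p + suc (diff r q)

  dist-≡ : ∀ {r s p q} → r ≡ p → dist r s p q ≡ diff s q
  dist-≡ {r} {p = p} r≡p with r ≟ p
  ... | yes _   = refl
  ... | no  r≢p = contradiction r≡p r≢p

  dist-≢ : ∀ {r s p q} → r ≢ p → dist r s p q ≡ diff s p + suc (diff r q)
  dist-≢ {r} {p = p} r≢p with r ≟ p
  ... | yes r≡p = contradiction r≡p r≢p
  ... | no  _   = refl

  dist-same-tail : ∀ r s t p q → dist r s p q ≤ suc (dist r t p q)
  dist-same-tail r s t p q with r ≟ p
  ... | yes _ = ℕ.≤-trans (diff-≤1 s q) (s≤s z≤n)
  ... | no  _ = ℕ.+-mono-≤ (diff-≤1 s p) (ℕ.m≤n+m _ (diff t p))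

  dist-reverse : ∀ r s p q → dist r s p q ≤ suc (dist s r p q)
  dist-reverse r s p q with r ≟ p | s ≟ p
  ... | yes _   | _       = ℕ.≤-trans (diff-≤1 s q) (s≤s z≤n)
  ... | no  _   | yes s≡p = ℕ.≤-reflexive (cong (_+ suc (diff r q)) (diff-≡ s≡p))
  -- Here the left side is at most 3, while `diff r p` is 1 and makes the right side at least 3.
  ... | no  r≢p | no  _   = ℕ.≤-trans
    (ℕ.+-mono-≤ (diff-≤1 s p) (s≤s (diff-≤1 r q)))
    (s≤s (ℕ.+-mono-≤ (ℕ.≤-reflexive (sym (diff-≢ r≢p))) (s≤s z≤n)))

  -- Vertices and adjacency of L(n) in terms of tail and head.

  infix 4 _∈ᴴ_ _≈ᴸ_ _~ᴸ_

  _∈ᴴ_ : HVertex n → Edge (H n) → Set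
  _∈ᴴ_ = _∈ₑ_ (H n)

  _≈ᴸ_ _~ᴸ_ : Edge (H n) → Edge (H n) → Set
  _≈ᴸ_ = Graph._≈_ (L n)
  _~ᴸ_ = Graph._~_ (L n)

  tail : Edge (H n) → Fin n
  tail (edge (point r)    (pair _ _ _) _) = r
  tail (edge (pair _ _ _) (point r)    _) = r

  head : Edge (H n) → Fin n
  head (edge (point _)    (pair i j _) (inj₁ _)) = j
  head (edge (point _)    (pair i j _) (inj₂ _)) = i
  head (edge (pair i j _) (point _)    (inj₁ _)) = j
  head (edge (pair i j _) (point _)    (inj₂ _)) = i

  tail≢head : ∀ e → tail e ≢ head e
  tail≢head (edge (point _) (pair i j i<j) (inj₁ refl)) i≡j = ⊥-elim-irr (<⇒≢ i<j i≡j)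
  tail≢head (edge (point _) (pair i j i<j) (inj₂ refl)) j≡i = ⊥-elim-irr (<⇒≢ i<j (sym j≡i))
  tail≢head (edge (pair i j i<j) (point _) (inj₁ refl)) i≡j = ⊥-elim-irr (<⇒≢ i<j i≡j)
  tail≢head (edge (pair i j i<j) (point _) (inj₂ refl)) j≡i = ⊥-elim-irr (<⇒≢ i<j (sym j≡i))

  SamePair : (i j r s : Fin n) → Set
  SamePair i j r s = (i ≡ r × j ≡ s) ⊎ (i ≡ s × j ≡ r)

  -- Endpoints read off from the code (r , s) alone, forgetting in which order an `Edge` lists its
  -- ends and whether r or s is smaller.
  Incident : HVertex n → Fin n → Fin n → Set
  Incident (point t)    r s = t ≡ r
  Incident (pair i j _) r s = SamePair i j r s

  SamePair⇒≡ : ∀ {i j k l} .{i<j : i < j} .{k<l : k < l} →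
    SamePair i j k l → pair i j i<j ≡ pair k l k<l
  SamePair⇒≡ (inj₁ (refl , refl)) = refl
  SamePair⇒≡ {i<j = i<j} {k<l = j<i} (inj₂ (refl , refl)) =
    ⊥-elim-irr (<-asym i<j j<i)

  ∈⇒Incident : ∀ e {x} → x ∈ᴴ e → Incident x (tail e) (head e)
  ∈⇒Incident (edge (point _) (pair _ _ _) _)           (inj₁ refl) = refl
  ∈⇒Incident (edge (point _) (pair _ _ _) (inj₁ refl)) (inj₂ refl) = inj₁ (refl , refl)
  ∈⇒Incident (edge (point _) (pair _ _ _) (inj₂ refl)) (inj₂ refl) = inj₂ (refl , refl)
  ∈⇒Incident (edge (pair _ _ _) (point _) _)           (inj₂ refl) = refl
  ∈⇒Incident (edge (pair _ _ _) (point _) (inj₁ refl)) (inj₁ refl) = inj₁ (refl , refl)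
  ∈⇒Incident (edge (pair _ _ _) (point _) (inj₂ refl)) (inj₁ refl) = inj₂ (refl , refl)

  Incident⇒∈ : ∀ e {x} → Incident x (tail e) (head e) → x ∈ᴴ e
  Incident⇒∈ (edge (point _) (pair _ _ _) _)           {point _}    refl = inj₁ refl
  Incident⇒∈ (edge (point _) (pair _ _ _) (inj₁ refl)) {pair _ _ _} inc  =
    inj₂ (SamePair⇒≡ inc)
  Incident⇒∈ (edge (point _) (pair _ _ _) (inj₂ refl)) {pair _ _ _} inc  =
    inj₂ (SamePair⇒≡ (Sum.swap inc))
  Incident⇒∈ (edge (pair _ _ _) (point _) _)           {point _}    refl = inj₂ refl
  Incident⇒∈ (edge (pair _ _ _) (point _) (inj₁ refl)) {pair _ _ _} inc  =
    inj₁ (SamePair⇒≡ inc)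
  Incident⇒∈ (edge (pair _ _ _) (point _) (inj₂ refl)) {pair _ _ _} inc  =
    inj₁ (SamePair⇒≡ (Sum.swap inc))

  -- With i and j the indices of a pair vertex common to two edges, this compares the codes of the
  -- edges up to a swap.
  SamePair-euclidean : ∀ {i j r s p q} →
    SamePair i j r s → SamePair i j p q → SamePair r s p q
  SamePair-euclidean (inj₁ (refl , refl)) (inj₁ (refl , refl)) = inj₁ (refl , refl)
  SamePair-euclidean (inj₁ (refl , refl)) (inj₂ (refl , refl)) = inj₂ (refl , refl)
  SamePair-euclidean (inj₂ (refl , refl)) (inj₁ (refl , refl)) = inj₂ (refl , refl)
  SamePair-euclidean (inj₂ (refl , refl)) (inj₂ (refl , refl)) = inj₁ (refl , refl)

  pairEnd : ∀ e → ∃[ i ] ∃[ j ] ∃[ i<j ] pair i j i<j ∈ᴴ e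
  -- The stored order proof is irrelevant; deciding the order recovers one that can be returned.
  pairEnd (edge (point _) (pair i j i<j) _) =
    i , j , recompute (i <? j) i<j , inj₂ refl
  pairEnd (edge (pair i j i<j) (point _) _) =
    i , j , recompute (i <? j) i<j , inj₁ refl

  ≡⇒≈ᴸ : ∀ {e f} → tail e ≡ tail f → head e ≡ head f → e ≈ᴸ f
  ≡⇒≈ᴸ tails heads x = mk⇔ (transfer tails heads) (transfer (sym tails) (sym heads))
    where
    transfer : ∀ {e f} → tail e ≡ tail f → head e ≡ head f → x ∈ᴴ e → x ∈ᴴ f
    transfer {e} {f} tails heads x∈e =
      Incident⇒∈ f (subst₂ (Incident x) tails heads (∈⇒Incident e x∈e))

  ≈ᴸ⇒≡ : ∀ {e f} → e ≈ᴸ f → tail e ≡ tail f × head e ≡ head f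
  ≈ᴸ⇒≡ {e} {f} e≈f = tails , heads
    where
    tails : tail e ≡ tail f
    tails = ∈⇒Incident f (to (e≈f (point (tail e))) (Incident⇒∈ e refl))

    heads : head e ≡ head f
    heads with pairEnd e
    ... | _ , _ , _ , p∈e
      with SamePair-euclidean (∈⇒Incident e p∈e) (∈⇒Incident f (to (e≈f _) p∈e))
    ... | inj₁ (_ , eq) = eq
    -- As the tails agree, a swap would make the tail of `f` its head.
    ... | inj₂ (eq , _) = contradiction (trans (sym tails) eq) (tail≢head f)

  -- A shared point is the tail of both edges; a shared pair makes the codes agree up to a swap, and
  -- without a swap the tails are equal.
  ~ᴸ⇒ : ∀ {e f} → e ~ᴸ f →
    tail e ≡ tail f ⊎ (tail e ≡ head f × head e ≡ tail f)
  ~ᴸ⇒ {e} {f} (_ , point _ , x∈e , x∈f) =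
    inj₁ (trans (sym (∈⇒Incident e x∈e)) (∈⇒Incident f x∈f))
  ~ᴸ⇒ {e} {f} (_ , pair _ _ _ , x∈e , x∈f) =
    Sum.map proj₁ id
      (SamePair-euclidean (∈⇒Incident e x∈e) (∈⇒Incident f x∈f))

  same-tail⇒~ᴸ : ∀ {e f} → tail e ≡ tail f → head e ≢ head f → e ~ᴸ f
  same-tail⇒~ᴸ {e} {f} tails heads≢ =
    heads≢ ∘ proj₂ ∘ ≈ᴸ⇒≡ {e} {f} ,
    point (tail e) , Incident⇒∈ e refl , Incident⇒∈ f tails

  reverse⇒~ᴸ : ∀ {e f} → tail e ≡ head f → head e ≡ tail f → e ~ᴸ f
  reverse⇒~ᴸ {e} {f} t≡h h≡t =
    (λ e≈f → tail≢head f (trans (sym (proj₁ (≈ᴸ⇒≡ {e} {f} e≈f))) t≡h)) ,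
    shared
    where
    shared : ∃[ x ] x ∈ᴴ e × x ∈ᴴ f
    shared with pairEnd e
    ... | i , j , i<j , p∈e = pair i j i<j , p∈e , Incident⇒∈ f
      (Sum.swap (subst₂ (SamePair i j) t≡h h≡t (∈⇒Incident e p∈e)))

  ∃-edge : ∀ {r s} → r ≢ s → ∃[ e ] tail e ≡ r × head e ≡ s
  ∃-edge {r} {s} r≢s with <-cmp r s
  ... | tri< r<s _ _   = edge (point r) (pair r s r<s) (inj₁ refl) , refl , refl
  ... | tri≈ _ r≡s _   = contradiction r≡s r≢s
  ... | tri> _ _ s<r   = edge (point r) (pair s r s<r) (inj₂ refl) , refl , refl

  -- The formula is the distance of L(n).

  distᴸ : Edge (H n) → Edge (H n) → ℕ
  distᴸ e f = dist (tail e) (head e) (tail f) (head f)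

  same-tail-walk : ∀ e f → tail e ≡ tail f → Walk (L n) e f (diff (head e) (head f))
  same-tail-walk e f tails with head e ≟ head f
  ... | yes heads = nil (≡⇒≈ᴸ {e} {f} tails heads)
  ... | no heads≢ = cons {y = f} (same-tail⇒~ᴸ {e} {f} tails heads≢) (nil (≡⇒≈ᴸ {f} {f} refl refl))

  -- For tails r ≠ p the walk from (r , s) to (p , q) turns the head to p, reverses (r , p) into (p
  -- , r), and turns the head to q.
  walkᴸ : ∀ e f → Walk (L n) e f (distᴸ e f)
  walkᴸ e f with tail e ≟ tail f
  ... | yes tails = same-tail-walk e f tails
  ... | no tails≢ with ∃-edge tails≢ | ∃-edge (≢-sym tails≢)
  ...   | g , tg , hg | h , th , hh =
    subst₂ (λ s r → Walk (L n) e f (diff (head e) s + suc (diff r (head f)))) hg hh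
      (walk-++ (L n) (same-tail-walk e g (sym tg))
        (cons (reverse⇒~ᴸ {g} {h} (trans tg (sym hh)) (trans hg (sym th)))
          (same-tail-walk h f th)))

  distᴸ-≈ : ∀ {e f} g → e ≈ᴸ f → distᴸ e g ≡ distᴸ f g
  distᴸ-≈ {e} {f} g e≈f with ≈ᴸ⇒≡ {e} {f} e≈f
  ... | tails , heads = cong₂ (λ r s → dist r s (tail g) (head g)) tails heads

  distᴸ-~ : ∀ {e f} g → e ~ᴸ f → distᴸ e g ≤ suc (distᴸ f g)
  distᴸ-~ {e} {f} g e~f with ~ᴸ⇒ {e} {f} e~f
  ... | inj₁ tails = subst (λ r → distᴸ e g ≤ suc (dist r (head f) (tail g) (head g)))
    tails (dist-same-tail (tail e) (head e) (head f) (tail g) (head g))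
  ... | inj₂ (t≡h , h≡t) =
    subst₂ (λ r s → distᴸ e g ≤ suc (dist r s (tail g) (head g)))
      h≡t t≡h (dist-reverse (tail e) (head e) (tail g) (head g))

  distᴸ-self : ∀ e → distᴸ e e ≡ 0
  distᴸ-self e = trans (dist-≡ {tail e} {head e} {tail e} {head e} refl) (diff-≡ {head e} refl)

  isDistanceᴸ : ∀ e f → IsDistance (L n) e f (distᴸ e f)
  -- No walk is shorter: the formula for the distance to `f` drops by at most one per step and
  -- vanishes at `f`.
  isDistanceᴸ e f = walkᴸ e f , λ k u → subst (distᴸ e f ≤_)
    (trans (cong (k +_) (distᴸ-self f)) (ℕ.+-identityʳ k))
    (walk-lipschitz (L n) (λ e → distᴸ e f)
      (λ {e} {g} e≈g → ℕ.≤-reflexive (distᴸ-≈ {e} {g} f e≈g))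
      (λ {e} {g} → distᴸ-~ {e} {g} f) u)

  -- The lower bound.

  same-tail-dist : ∀ {r s t} p q → r ≢ p → s ≢ p → t ≢ p → dist r s p q ≡ dist r t p q
  same-tail-dist {r} p q r≢p s≢p t≢p = trans (dist-≢ r≢p) (trans
    (cong (_+ suc (diff r q)) (trans (diff-≢ s≢p) (sym (diff-≢ t≢p))))
    (sym (dist-≢ r≢p)))

  resolving⇒n≤2+length : ∀ Q → Resolving (L n) Q → n ≤ 2 + length Q
  resolving⇒n≤2+length Q resolves = ℕ.≮⇒≥ λ short →
    let short′  = subst (λ k → 2 + k ℕ.< n) (sym (length-map tail Q)) short
        -- Each new point avoids the tails and the points chosen before; the last list has
        -- `2 + length Q` entries, still fewer than n.
        a , a∉  = ∃-∉ (map tail Q) (ℕ.m+n≤o⇒n≤o 2 short′)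
        b , b∉  = ∃-∉ (a ∷ map tail Q) (ℕ.m+n≤o⇒n≤o 1 short′)
        c , c∉  = ∃-∉ (b ∷ a ∷ map tail Q) short′
        e , te , he = ∃-edge {a} {b} (λ a≡b → b∉ (here (sym a≡b)))
        f , tf , hf = ∃-edge {a} {c} (λ a≡c → c∉ (there (here (sym a≡c))))
        e≉f : ¬ e ≈ᴸ f
        e≉f e≈f = c∉ (here (trans (sym hf) (trans (sym (proj₂ (≈ᴸ⇒≡ {e} {f} e≈f))) he)))
        equidistant : ∀ {q} → q ∈ Q → distᴸ e q ≡ distᴸ f q
        equidistant {q} q∈Q =
          let tq∈ = ∈-map⁺ tail q∈Q in
          trans (cong₂ (λ r s → dist r s (tail q) (head q)) te he) (trans
            -- The head enters only through its comparison with the tail of `q`, which differs from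
            -- both b and c.
            (same-tail-dist (tail q) (head q)
              (λ eq → a∉ (subst (_∈ _) (sym eq) tq∈))
              (λ eq → b∉ (there (subst (_∈ _) (sym eq) tq∈)))
              (λ eq → c∉ (there (there (subst (_∈ _) (sym eq) tq∈)))))
            (sym (cong₂ (λ r s → dist r s (tail q) (head q)) tf hf)))
    in resolves e f e≉f
         (All.tabulate (λ q∈Q → ≡⇒SameDistance (L n) isDistanceᴸ (equidistant q∈Q)))

-- A resolving set with n - 2 vertices.

-- The points a and b of the resolving set are zero and suc zero.
module _ {m : ℕ} where

  private
    Point = Fin (2 + m)

  inner : Fin m → Point
  inner i = suc (suc i)

  basisEdge : Fin m → Edge (H (2 + m))
  basisEdge i = proj₁ (∃-edge {r = inner i} {zero} λ ())

  tail-basisEdge : ∀ i → tail (basisEdge i) ≡ inner i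
  tail-basisEdge i = proj₁ (proj₂ (∃-edge {r = inner i} {zero} λ ()))

  head-basisEdge : ∀ i → head (basisEdge i) ≡ zero
  head-basisEdge i = proj₂ (proj₂ (∃-edge {r = inner i} {zero} λ ()))

  basis : List (Edge (H (2 + m)))
  basis = tabulate basisEdge

  basisEdge-injective : ∀ {i j} → basisEdge i ≈ᴸ basisEdge j → i ≡ j
  basisEdge-injective {i} {j} i≈j = suc-injective (suc-injective
    (trans (sym (tail-basisEdge i))
      (trans (proj₁ (≈ᴸ⇒≡ {e = basisEdge i} {basisEdge j} i≈j)) (tail-basisEdge j))))

  -- Recovering head and tail from the distances to the basis.

  -- A record, so that r, s, p and q can be inferred from a proof.
  record SameCode (r s p q : Point) : Set where
    constructor sameCode
    field at : ∀ i → dist r s (inner i) zero ≡ dist p q (inner i) zero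

  open SameCode

  SameCode-sym : ∀ {r s p q} → SameCode r s p q → SameCode p q r s
  SameCode-sym same = sameCode (sym ∘ at same)

  -- The summand `suc (diff r zero)` depends on the tail only and cancels.
  diff-code : ∀ {r s q i} → r ≢ inner i →
    dist r s (inner i) zero ≡ dist r q (inner i) zero →
    diff s (inner i) ≡ diff q (inner i)
  diff-code {r} {s} {q} {i} r≢i eq = ℕ.+-cancelʳ-≡ (suc (diff r zero)) _ _
    (trans (sym (dist-≢ r≢i)) (trans eq (dist-≢ r≢i)))

  head-inner : ∀ {r i q} → r ≢ inner i → SameCode r (inner i) r q → q ≡ inner i
  head-inner {r} {i} {q} r≢i same = diff≡0⇒≡
    (trans (sym (diff-code {r} {inner i} {q} r≢i (at same i))) (diff-≡ {i = inner i} refl))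

  -- Only the basis edge with tail r tells these heads apart, by distances 0 and 1; it exists
  -- because r is neither a nor b.
  head-zero-one : ∀ {r} → r ≢ zero → r ≢ suc zero → ¬ SameCode r zero r (suc zero)
  head-zero-one {zero}        r≢0 r≢1 _ = r≢0 refl
  head-zero-one {suc zero}    r≢0 r≢1 _ = r≢1 refl
  head-zero-one {suc (suc i)} r≢0 r≢1 same = contradiction
    (trans (sym (dist-≡ {r = inner i} {zero} {q = zero} refl))
      (trans (at same i) (dist-≡ {r = inner i} {suc zero} {q = zero} refl))) λ ()

  head-unique : ∀ {r s q} → r ≢ s → r ≢ q → SameCode r s r q → s ≡ q
  head-unique {s = suc (suc i)} r≢s r≢q same = sym (head-inner r≢s same)
  head-unique {q = suc (suc i)} r≢s r≢q same = head-inner r≢q (SameCode-sym same)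
  head-unique {s = zero}     {zero}     _   _   _    = refl
  head-unique {s = suc zero} {suc zero} _   _   _    = refl
  head-unique {s = zero}     {suc zero} r≢s r≢q same =
    contradiction same (head-zero-one r≢s r≢q)
  head-unique {s = suc zero} {zero}     r≢s r≢q same =
    contradiction (SameCode-sym same) (head-zero-one r≢q r≢s)

  code-tail≤1 : ∀ s i → dist (inner i) s (inner i) zero ≤ 1
  code-tail≤1 s i = ℕ.≤-trans
    (ℕ.≤-reflexive (dist-≡ {r = inner i} {s} {q = zero} refl)) (diff-≤1 s zero)

  code-nontail≥2 : ∀ {p q i} → p ≢ zero → p ≢ inner i → 2 ≤ dist p q (inner i) zero
  code-nontail≥2 {p} {q} {i} p≢0 p≢i = subst (2 ≤_)
    (sym (trans (dist-≢ p≢i) (cong (λ k → diff q (inner i) + suc k) (diff-≢ p≢0))))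
    (ℕ.m≤n+m 2 (diff q (inner i)))

  code-zero≤2 : ∀ s i → dist zero s (inner i) zero ≤ 2
  -- The distance computes to `diff s (inner i) + 1`, as `diff zero zero` is 0.
  code-zero≤2 s i = ℕ.+-monoˡ-≤ 1 (diff-≤1 s (inner i))

  code≡3 : ∀ {p q i} → p ≢ zero → p ≢ inner i → q ≢ inner i →
    dist p q (inner i) zero ≡ 3
  code≡3 p≢0 p≢i q≢i =
    trans (dist-≢ p≢i) (cong₂ (λ k l → k + suc l) (diff-≢ q≢i) (diff-≢ p≢0))

  -- There are at least five points, and only a, b, p and q are to be avoided.
  ∃-inner-∉ : 3 ≤ m → ∀ p q → ∃[ i ] p ≢ inner i × q ≢ inner i
  ∃-inner-∉ 3≤m p q
    with ∃-∉ (zero ∷ suc zero ∷ p ∷ q ∷ []) (s≤s (s≤s 3≤m))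
  ... | zero        , x∉ = contradiction (here refl) x∉
  ... | suc zero    , x∉ = contradiction (there (here refl)) x∉
  ... | suc (suc i) , x∉ =
    i , (λ { refl → x∉ (there (there (here refl))) }) ,
        (λ { refl → x∉ (there (there (there (here refl)))) })

  -- A basis edge whose tail is neither p nor q is at distance 3 from (p , q), but at most 2 from (a
  -- , s).
  tail-zero : 3 ≤ m → ∀ {s p q} → p ≢ zero → ¬ SameCode zero s p q
  tail-zero 3≤m {s} {p} {q} p≢0 same with ∃-inner-∉ 3≤m p q
  ... | i , p≢i , q≢i = ℕ.<⇒≱ ℕ.≤-refl
    (subst (_≤ 2) (trans (at same i) (code≡3 p≢0 p≢i q≢i)) (code-zero≤2 s i))

  tail-inner : ∀ {i s p q} → p ≢ zero → p ≢ inner i → ¬ SameCode (inner i) s p q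
  tail-inner {i} {s} p≢0 p≢i same = ℕ.<⇒≱ (code-nontail≥2 p≢0 p≢i)
    (subst (_≤ 1) (at same i) (code-tail≤1 s i))

  -- Of two different tails one is not b, hence is a or the tail of a basis edge. Tail a is settled
  -- first, since `tail-inner` requires the other tail to differ from a.
  tail-unique : 3 ≤ m → ∀ {r s p q} → SameCode r s p q → r ≡ p
  tail-unique 3≤m {zero}        {p = zero}        same = refl
  tail-unique 3≤m {zero}        {p = suc _}       same = contradiction same (tail-zero 3≤m λ ())
  tail-unique 3≤m {suc _}       {p = zero}        same =
    contradiction (SameCode-sym same) (tail-zero 3≤m λ ())
  tail-unique 3≤m {suc zero}    {p = suc zero}    same = refl
  tail-unique 3≤m {suc zero}    {p = suc (suc k)} same =
    contradiction (SameCode-sym same) (tail-inner (λ ()) λ ())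
  tail-unique 3≤m {suc (suc i)} {p = suc p}       same with suc p ≟ inner i
  ... | yes p≡i = sym p≡i
  ... | no  p≢i = contradiction same (tail-inner (λ ()) p≢i)

  basis-resolving : 3 ≤ m → Resolving (L (2 + m)) basis
  basis-resolving 3≤m e f e≉f same = e≉f (≡⇒≈ᴸ {e = e} {f} tails heads)
    where
    codes : SameCode (tail e) (head e) (tail f) (head f)
    codes = sameCode λ i → subst₂ (λ p q → dist (tail e) (head e) p q ≡ dist (tail f) (head f) p q)
      (tail-basisEdge i) (head-basisEdge i)
      (SameDistance⇒≡ (L (2 + m)) isDistanceᴸ (tabulate⁻ same i))

    tails : tail e ≡ tail f
    tails = tail-unique 3≤m codes

    heads : head e ≡ head f
    heads = head-unique (tail≢head e) (tail≢head f ∘ trans (sym tails))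
      (subst (λ r → SameCode (tail e) (head e) r (head f)) (sym tails) codes)

theorem3p8 : ∀ (n : ℕ) → 5 ≤ n → MetricDimension (L n) (n ∸ 2)
theorem3p8 (suc (suc m)) (s≤s (s≤s 3≤m)) =
  ( basis
  , Uniqueₛ.tabulate⁺ (Graph.vertices (L (2 + m))) basisEdge-injective
  , basis-resolving 3≤m
  , length-tabulate {n = m} basisEdge ) ,
  -- With n written as `2 + m`, the value `n ∸ 2` computes to `m`.
  λ Q _ resolves → ℕ.+-cancelˡ-≤ 2 _ _ (resolving⇒n≤2+length Q resolves)
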